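{- Let $q=p^s$ be a prime power which is a perfect square, let $d\ge 2$ with $d\mid(\sqrt q+1)$, and let $\lambda\in\mathbb{F}_q^*$. Suppose there is $\alpha\in\mathbb{F}_q$ with $\alpha^2\in S_d$ and $\lambda\in\alpha^2\mathbb{F}_{\sqrt q}^*$. Let $r$ be the remainder of $\frac{q-1}{d}$ upon division by $p\sqrt q$, and suppose $r\le (p-1)\sqrt q$. Then $MSD_d(\lambda,\mathbb{F}_q)=\sqrt q-1$. If in addition $q\ge 25$ and $d\ge 3$, then $MD_d(\lambda,\mathbb{F}_q)=\sqrt q-1$.
   Context: $p$ is the characteristic of $\mathbb{F}_q$, and $\mathbb{F}_{\sqrt q}$ is the subfield of $\mathbb{F}_q$ of order $\sqrt q$. $S_d=\{x^d:x\in\mathbb{F}_q^*\}$. A set of distinct elements $a_1,\dots,a_m$ of $\mathbb{F}_q^*$ has property $D_d(\lambda,\mathbb{F}_q)$ if $a_ia_j+\lambda\in S_d\cup\{0\}$ whenever $i\ne j$, and property $SD_d(\lambda,\mathbb{F}_q)$ if $a_ia_j+\lambda\in S_d\cup\{0\}$ for all $i,j$ (including $i=j$). $MD_d(\lambda,\mathbb{F}_q)$, $MSD_d(\lambda,\mathbb{F}_q)$ are the maximum sizes of subsets of $\mathbb{F}_q^*$ with these respective properties. -}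

module Defs where

open import Level using (0ℓ)
open import Data.Nat as ℕ using (ℕ; zero; suc)
open import Data.Fin using (Fin)
open import Data.Product using (Σ; ∃; _×_; _,_)
open import Data.Sum using (_⊎_)
open import Relation.Binary.PropositionalEquality using (_≡_; _≢_)
open import Algebra.Structures using (IsCommutativeRing)
open import Function.Bundles using (_↔_)
open import Function.Definitions using (Injective)

record FiniteField : Set₁ where
  infixl 6 _+_
  infixl 7 _*_
  field
    F        : Set
    _+_ _*_  : F → F → F
    -_       : F → F
    0# 1#    : F
    isCommutativeRing : IsCommutativeRing _≡_ _+_ _*_ -_ 0# 1#
    0≢1      : 0# ≢ 1#
    inverse  : ∀ x → x ≢ 0# → ∃ λ y → x * y ≡ 1#
    order    : ℕ
    enum     : F ↔ Fin order

  _^_ : F → ℕ → F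
  x ^ zero  = 1#
  x ^ suc n = x * (x ^ n)

  fromℕ : ℕ → F
  fromℕ zero    = 0#
  fromℕ (suc n) = 1# + fromℕ n

  InS : ℕ → F → Set
  InS d y = ∃ λ x → x ≢ 0# × x ^ d ≡ y

  InS₀ : ℕ → F → Set
  InS₀ d y = InS d y ⊎ y ≡ 0#

  DistinctNonzero : (m : ℕ) → (Fin m → F) → Set
  DistinctNonzero m a = Injective _≡_ _≡_ a × (∀ i → a i ≢ 0#)

  HasD : ℕ → F → (m : ℕ) → (Fin m → F) → Set
  HasD d λ' m a = DistinctNonzero m a × (∀ i j → i ≢ j → InS₀ d (a i * a j + λ'))

  HasSD : ℕ → F → (m : ℕ) → (Fin m → F) → Set
  HasSD d λ' m a = DistinctNonzero m a × (∀ i j → InS₀ d (a i * a j + λ'))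

  IsMaxSize : ((m : ℕ) → (Fin m → F) → Set) → ℕ → Set
  IsMaxSize P n = (Σ (Fin n → F) λ a → P n a) × (∀ m a → P m a → m ℕ.≤ n)

  MD≡ : ℕ → F → ℕ → Set
  MD≡ d λ' = IsMaxSize (HasD d λ')

  MSD≡ : ℕ → F → ℕ → Set
  MSD≡ d λ' = IsMaxSize (HasSD d λ')

module Submission where

-- Write t = √q and t + 1 = m d, so that y ∈ S_d ∪ {0} gives y^(tm) = y^m.  Suppose |A| ≥ t and let
-- e_0, …, e_t consist of 0 and t elements of A (0 may be added since λ ∈ S_d).  The divided
-- difference at these points is a functional f ↦ Σ c_i f(e_i) that kills degrees below t and is 1
-- on X^t.  For a polynomial P put H_P(y) = Σ c_i P(e_i) (e_i^t y + λ^t)^m, of degree at most m in y.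
-- By Frobenius H_P(e_j^t) = Σ c_i P(e_i) (e_i e_j + λ)^(tm), and if the exponent tm could be replaced
-- by m in every term, this would be 0 as soon as deg P + m < t.  Only the term i = j can fail, so
-- H_P(e_j^t) = P(e_j) D_j for a number D_j independent of P.
-- The coefficient of y in H_1 is m λ^(t(m-1)) ≠ 0 and t + 1 > m, hence the D_j are not all 0; this
-- settles SD_d, where D_j = 0.  For D_d with d ≥ 3 and q ≥ 25 we have 2m < t, so P may be chosen of
-- degree m with m prescribed roots among the e_i; then H_P has m + 1 roots (0 is one more), so it
-- is zero and D_j = 0 for all remaining j.
-- For the lower bound take A = α F_t^*; the norm x ↦ x^(t+1) maps onto F_t^* by counting fibres,
-- which shows both |F_t^*| = t - 1 and F_t^* ⊆ S_d.

open import Defs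
open import Level using (0ℓ)
open import Algebra.Bundles using (CommutativeRing)
import Data.Nat as ℕ
open import Data.Nat using (ℕ; zero; suc; _∸_; _≤_; _<_; z≤n; s≤s; _/_; _%_; NonZero; _!)
import Data.Nat.Properties as ℕ
open import Data.Nat.Combinatorics using (_C_; nCk≡n!/k![n-k]!; nCn≡1; k![n∸k]!∣n!)
open import Data.Nat.DivMod using (m/n*n≡m)
open import Data.Nat.Divisibility using (_∣_; divides; m∣m*n; ∣⇒≤)
open import Data.Nat.Primality using (Prime; euclidsLemma; prime⇒nonZero; prime⇒nonTrivial)
open import Data.Fin using (Fin; zero; suc; inject≤; punchIn)
import Data.Fin.Properties as Fin
open import Data.List as List using (List; []; _∷_; length; filter; map; deduplicate)
open import Data.List.Membership.Propositional using (_∈_)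
open import Data.List.Membership.Propositional.Properties
  using (∈-map⁺; ∈-map⁻; ∈-deduplicate⁺; ∈-deduplicate⁻; ∈-lookup; ∈-tabulate⁻)
open import Data.List.Properties using (length-tabulate)
open import Data.List.Relation.Unary.All as All using (All; []; _∷_)
import Data.List.Relation.Unary.All.Properties as All
open import Data.List.Relation.Unary.Any as Any using (here; there)
open import Data.List.Relation.Unary.AllPairs using ([]; _∷_)
open import Data.List.Relation.Unary.Unique.Propositional using (Unique)
import Data.List.Relation.Unary.Unique.Propositional.Properties as Unique
import Data.List.Relation.Unary.Unique.DecPropositional.Properties as DecUnique
open import Data.Product using (Σ; ∃; _×_; _,_; proj₁; proj₂)
open import Data.Sum using (inj₁; inj₂)
open import Data.Vec.Functional using (Vector; tail; init; last; removeAt; replicate)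
open import Function using (_∘_; Injective; _↔_; mk↔ₛ′)
open import Function.Bundles using (Inverse)
open import Function.Construct.Composition using (_↔-∘_)
open import Function.Construct.Symmetry using (↔-sym)
open import Function.Properties.Inverse using (↔⇒↣)
open import Relation.Binary using (DecidableEquality)
open import Relation.Binary.PropositionalEquality
open import Relation.Nullary using (¬_; ¬?; yes; no; contradiction)
open import Relation.Unary using (Pred; Decidable)

-- Primes, binomial coefficients and square roots of prime powers.

prime∤! : ∀ {p} → Prime p → ∀ k → k < p → ¬ p ∣ k !
prime∤! {p} pp zero k<p p∣1 =
  ℕ.<⇒≱ (ℕ.nonTrivial⇒n>1 p {{prime⇒nonTrivial pp}}) (∣⇒≤ p∣1)
prime∤! pp (suc k) k<p p∣k! with euclidsLemma (suc k) (k !) pp p∣k!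
... | inj₁ p∣k = ℕ.<⇒≱ k<p (∣⇒≤ p∣k)
... | inj₂ p∣! = prime∤! pp k (ℕ.<-trans (ℕ.n<1+n k) k<p) p∣!

-- `p` divides `p !`, which is the coefficient times two factorials of numbers below `p`. This kills
-- the middle terms in `frobenius`.
prime∣C : ∀ {p k} → Prime p → 0 < k → k < p → p ∣ p C k
prime∣C {p@(suc p-1)} {k} pp 0<k k<p
  with euclidsLemma (p C k) (k ! ℕ.* (p ℕ.∸ k) !) pp (subst (p ∣_) (sym eq) (m∣m*n (p-1 !)))
  where
  eq : (p C k) ℕ.* (k ! ℕ.* (p ℕ.∸ k) !) ≡ p !
  eq = trans (cong (ℕ._* (k ! ℕ.* (p ℕ.∸ k) !)) (nCk≡n!/k![n-k]! (ℕ.<⇒≤ k<p)))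
    (m/n*n≡m {{_}} (k![n∸k]!∣n! (ℕ.<⇒≤ k<p)))
... | inj₁ p∣C = p∣C
... | inj₂ p∣k![p-k]! with euclidsLemma (k !) ((p ℕ.∸ k) !) pp p∣k![p-k]!
...   | inj₁ p∣! = contradiction p∣! (prime∤! pp k k<p)
...   | inj₂ p∣! = contradiction p∣! (prime∤! pp (p ℕ.∸ k) (ℕ.∸-monoʳ-< 0<k (ℕ.<⇒≤ k<p)))

-- By Euclid `p` divides `t`, and dividing `t` by `p` lowers the exponent by two, so the induction
-- goes in steps of two.
sqrt-of-prime-power : ∀ {p} → Prime p → ∀ s {t} → t ℕ.* t ≡ p ℕ.^ s → ∃ λ e → t ≡ p ℕ.^ e
sqrt-of-prime-power pp zero {t} tt≡1 = 0 , ℕ.m*n≡1⇒m≡1 t t tt≡1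
sqrt-of-prime-power {p} pp (suc s) {t} tt≡pˢ = go p∣t
  where
  instance _ = prime⇒nonZero pp
  p∣t : p ∣ t
  p∣t with euclidsLemma t t pp (subst (p ∣_) (sym tt≡pˢ) (m∣m*n (p ℕ.^ s)))
  ... | inj₁ p∣t = p∣t
  ... | inj₂ p∣t = p∣t

  go : p ∣ t → ∃ λ e → t ≡ p ℕ.^ e
  go (divides q t≡qp) = descend s pqq≡pˢ
    where
    open ≡-Reasoning
    pqq≡pˢ : p ℕ.* (q ℕ.* q) ≡ p ℕ.^ s
    pqq≡pˢ = ℕ.*-cancelˡ-≡ _ _ p (begin
      p ℕ.* (p ℕ.* (q ℕ.* q))    ≡⟨ ℕ.*-assoc p p (q ℕ.* q) ⟨
      (p ℕ.* p) ℕ.* (q ℕ.* q)    ≡⟨ ℕ.[m*n]*[o*p]≡[m*o]*[n*p] p p q q ⟩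
      (p ℕ.* q) ℕ.* (p ℕ.* q)    ≡⟨ cong (λ z → z ℕ.* z) (trans (ℕ.*-comm p q) (sym t≡qp)) ⟩
      t ℕ.* t                    ≡⟨ tt≡pˢ ⟩
      p ℕ.* p ℕ.^ s              ∎)

    descend : ∀ s → p ℕ.* (q ℕ.* q) ≡ p ℕ.^ s → ∃ λ e → t ≡ p ℕ.^ e
    -- The exponent was 1, and the remaining equation makes `p` equal to 1.
    descend zero eq = contradiction (ℕ.m*n≡1⇒m≡1 p (q ℕ.* q) eq)
      (ℕ.nonTrivial⇒≢1 {{prime⇒nonTrivial pp}})
    descend (suc s) eq with e , q≡pᵉ ← sqrt-of-prime-power pp s (ℕ.*-cancelˡ-≡ _ _ p eq) =
      suc e , trans t≡qp (trans (ℕ.*-comm q p) (cong (p ℕ.*_) q≡pᵉ))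

-- Counting lists by fibres.

module _ {a} {A : Set a} where

  length-filter-∁ : ∀ {ℓ} {P : Pred A ℓ} (P? : Decidable P) xs →
                    length xs ≡ length (filter P? xs) ℕ.+ length (filter (¬? ∘ P?) xs)
  length-filter-∁ P? []       = refl
  length-filter-∁ P? (x ∷ xs) with P? x
  ... | yes _ = cong suc (length-filter-∁ P? xs)
  ... | no _  = trans (cong suc (length-filter-∁ P? xs)) (sym (ℕ.+-suc _ _))

  lookup-injective : ∀ {xs : List A} → Unique xs → Injective _≡_ _≡_ (List.lookup xs)
  lookup-injective (_ ∷ _)    {zero}  {zero}  _  = refl
  lookup-injective (x∉xs ∷ _) {zero}  {suc j} eq = contradiction eq (All.lookup x∉xs (∈-lookup j))
  lookup-injective (x∉xs ∷ _) {suc i} {zero}  eq = contradiction (sym eq) (All.lookup x∉xs (∈-lookup i))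
  lookup-injective (_ ∷ xs!)  {suc i} {suc j} eq = cong suc (lookup-injective xs! eq)

  -- Remove the fibre over the first value, at most `w` elements; the rest maps into the remaining
  -- values. Applied to the norm, this bounds the number of its values from below.
  length≤fibre*image : (_≟_ : DecidableEquality A) (φ : A → A) (w : ℕ) →
    (∀ c xs → Unique xs → All (λ x → φ x ≡ c) xs → length xs ≤ w) →
    ∀ ys xs → Unique xs → All (λ x → φ x ∈ ys) xs → length xs ≤ length ys ℕ.* w
  length≤fibre*image _≟_ φ w fibre≤w [] []       xs! φxs∈ys = z≤n
  length≤fibre*image _≟_ φ w fibre≤w [] (x ∷ xs) xs! (() ∷ _)
  length≤fibre*image _≟_ φ w fibre≤w (y ∷ ys) xs xs! φxs∈ys = begin
    length xs
      ≡⟨ length-filter-∁ P? xs ⟩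
    length (filter P? xs) ℕ.+ length (filter (¬? ∘ P?) xs)
      ≤⟨ ℕ.+-mono-≤
           (fibre≤w y _ (Unique.filter⁺ P? xs!) (All.all-filter P? xs))
           (length≤fibre*image _≟_ φ w fibre≤w ys _ (Unique.filter⁺ (¬? ∘ P?) xs!) rest) ⟩
    w ℕ.+ length ys ℕ.* w ∎
    where
    open ℕ.≤-Reasoning
    P? : Decidable λ x → φ x ≡ y
    P? x = φ x ≟ y
    rest : All (λ x → φ x ∈ ys) (filter (¬? ∘ P?) xs)
    rest = All.zipWith
      (λ { (φx≢y , here φx≡y) → contradiction φx≡y φx≢y ; (_ , there φx∈ys) → φx∈ys })
      (All.all-filter (¬? ∘ P?) xs , All.filter⁺ (¬? ∘ P?) φxs∈ys)

-- Numerical relations between m, d and t.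

m<t : ∀ {m t d} → suc t ≡ m ℕ.* d → 2 ≤ d → 2 ≤ t → m < t
m<t {m} {t} {d} 1+t≡md 2≤d 2≤t = ℕ.≰⇒> λ t≤m → ℕ.<⇒≱ 2≤t (ℕ.+-cancelʳ-≤ t t 1 (begin
  t ℕ.+ t    ≡⟨ cong (t ℕ.+_) (ℕ.+-identityʳ t) ⟨
  2 ℕ.* t    ≡⟨ ℕ.*-comm 2 t ⟩
  t ℕ.* 2    ≤⟨ ℕ.*-mono-≤ t≤m 2≤d ⟩
  m ℕ.* d    ≡⟨ 1+t≡md ⟨
  1 ℕ.+ t    ∎))
  where open ℕ.≤-Reasoning

-- If t ≤ 2m then 3t ≤ 2md = 2t + 2, so t ≤ 2. The left side of the conclusion counts the
-- coefficients of an m-th power of a linear form times a polynomial of degree m.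
2m<t : ∀ {m t d} → suc t ≡ m ℕ.* d → 3 ≤ d → 5 ≤ t → m ℕ.+ suc m ≤ t
2m<t {m} {t} {d} 1+t≡md 3≤d 5≤t = subst (_≤ t) (sym (ℕ.+-suc m m)) (ℕ.≰⇒> λ t≤2m →
  ℕ.<⇒≱ 5≤t (ℕ.≤-trans (ℕ.+-cancelʳ-≤ (2 ℕ.* t) t 2 (begin
    t ℕ.+ 2 ℕ.* t              ≡⟨ ℕ.*-comm 3 t ⟩
    t ℕ.* 3                    ≤⟨ ℕ.*-mono-≤ t≤2m 3≤d ⟩
    (m ℕ.+ m) ℕ.* d            ≡⟨ ℕ.*-distribʳ-+ d m m ⟩
    m ℕ.* d ℕ.+ m ℕ.* d        ≡⟨ cong₂ ℕ._+_ 1+t≡md 1+t≡md ⟨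
    suc t ℕ.+ suc t            ≡⟨ cong (suc t ℕ.+_) (ℕ.+-identityʳ (suc t)) ⟨
    2 ℕ.* suc t                ≡⟨ ℕ.*-distribˡ-+ 2 1 t ⟩
    2 ℕ.+ 2 ℕ.* t              ∎)) (s≤s (s≤s z≤n))))
  where open ℕ.≤-Reasoning

n*n≡1+[n∸1]*[1+n] : ∀ {n} → 0 < n → n ℕ.* n ≡ suc ((n ∸ 1) ℕ.* suc n)
n*n≡1+[n∸1]*[1+n] {suc n} _ = cong suc (sym (ℕ.*-suc n (suc n)))

-- Supplies the places for the prescribed roots of P, away from the index whose defect is being
-- studied.
avoiding : ∀ {m t} → m ≤ t ∸ 1 → (j : Fin t) →
           Σ (Fin m → Fin t) λ ι → Injective _≡_ _≡_ ι × (∀ l → ι l ≢ j)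
avoiding {t = suc t} m≤t j = (λ l → punchIn j (inject≤ l m≤t)) ,
  Fin.inject≤-injective _ _ _ _ ∘ Fin.punchIn-injective j _ _ , λ _ → Fin.punchInᵢ≢i j _

-- Arithmetic in the field.

module Field (K : FiniteField) where

  open FiniteField K public
    using (F; 0≢1; inverse; order; enum; fromℕ; InS; InS₀; HasD; HasSD; MD≡; MSD≡)
    renaming (_^_ to _^ᴷ_)

  commutativeRing : CommutativeRing 0ℓ 0ℓ
  commutativeRing = record { isCommutativeRing = FiniteField.isCommutativeRing K }

  open CommutativeRing commutativeRing public
    using ( _+_; _*_; -_; _-_; 0#; 1#; +-comm; *-comm; *-assoc; zeroˡ; zeroʳ
          ; +-identityˡ; +-identityʳ; *-identityˡ; *-identityʳ
          ; -‿inverseˡ; -‿inverseʳ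
          ; ring; semiring; commutativeSemiring; *-commutativeMonoid; +-group)
  open import Algebra.Properties.Semiring.Sum semiring public
    using (sum; sum-cong-≗; ∑-distrib-+; *-distribˡ-sum; sum-remove; sum-replicate-zero; sum-init-last)
  open import Algebra.Properties.CommutativeSemiring.Exp commutativeSemiring public
    using (_^_; ^-homo-*; ^-assocʳ; ^-distrib-*)
  open import Algebra.Properties.Semiring.Mult semiring public
    using (×1-homo-*; ×-assoc-*; ×-comm-*)
    renaming (_×_ to _·_)
  open import Algebra.Properties.Ring ring public using (x[y-z]≈xy-xz)
  open import Algebra.Properties.Group +-group public
    using () renaming (x∙y⁻¹≈ε⇒x≈y to x-y≡0⇒x≡y; x≈y⇒x∙y⁻¹≈ε to x≡y⇒x-y≡0)

  open import Algebra.Solver.Ring.NaturalCoefficients.Default commutativeSemiring public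
    using (solve; con; _:+_; _:*_; _:=_)
  open import Algebra.Properties.CommutativeSemiring.Binomial commutativeSemiring
    using (binomialTerm; theorem)
  open import Algebra.Properties.CommutativeMonoid.Sum *-commutativeMonoid
    using () renaming
    ( sum to product; sum-permute to product-permute; ∑-distrib-+ to ∏-distrib-*
    ; sum-cong-≗ to product-cong; sum-remove to product-remove; sum-replicate to product-replicate)
  open ≡-Reasoning

  infix 4 _≟_
  _≟_ : DecidableEquality F
  _≟_ = Fin.inj⇒≟ (↔⇒↣ enum)

  -- Bridges the power used in the statement and the one whose exponent laws are used below.
  ^ᴷ≡^ : ∀ x n → x ^ᴷ n ≡ x ^ n
  ^ᴷ≡^ x zero    = refl
  ^ᴷ≡^ x (suc n) = cong (x *_) (^ᴷ≡^ x n)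

  fromℕ≡·1 : ∀ n → fromℕ n ≡ n · 1#
  fromℕ≡·1 zero    = refl
  fromℕ≡·1 (suc n) = cong (1# +_) (fromℕ≡·1 n)

  xy≡0⇒y≡0 : ∀ {x y} → x ≢ 0# → x * y ≡ 0# → y ≡ 0#
  xy≡0⇒y≡0 {x} {y} x≢0 xy≡0 with z , xz≡1 ← inverse x x≢0 = begin
    y            ≡⟨ *-identityˡ y ⟨
    1# * y       ≡⟨ cong (_* y) xz≡1 ⟨
    x * z * y    ≡⟨ solve 3 (λ x y z → x :* z :* y := z :* (x :* y)) refl x y z ⟩
    z * (x * y)  ≡⟨ cong (z *_) xy≡0 ⟩
    z * 0#       ≡⟨ zeroʳ z ⟩
    0#           ∎

  *-nonzero : ∀ {x y} → x ≢ 0# → y ≢ 0# → x * y ≢ 0#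
  *-nonzero x≢0 y≢0 = y≢0 ∘ xy≡0⇒y≡0 x≢0

  *-cancelˡ : ∀ x {y z} → x ≢ 0# → x * y ≡ x * z → y ≡ z
  *-cancelˡ x {y} {z} x≢0 xy≡xz = x-y≡0⇒x≡y y z (xy≡0⇒y≡0 x≢0 (begin
    x * (y - z)    ≡⟨ x[y-z]≈xy-xz x y z ⟩
    x * y - x * z  ≡⟨ x≡y⇒x-y≡0 xy≡xz ⟩
    0#             ∎))

  ^-nonzero : ∀ {x} n → x ≢ 0# → x ^ n ≢ 0#
  ^-nonzero zero    x≢0 = 0≢1 ∘ sym
  ^-nonzero (suc n) x≢0 = *-nonzero x≢0 (^-nonzero n x≢0)

  0^n : ∀ {n} → 0 < n → 0# ^ n ≡ 0#
  0^n {suc n} _ = zeroˡ _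

  sum-zero : ∀ {n} {f : Vector F n} → (∀ i → f i ≡ 0#) → sum f ≡ 0#
  sum-zero {n} f≡0 = trans (sum-cong-≗ f≡0) (sum-replicate-zero n)

  sum-*-+ : ∀ {n} x (f g : Vector F n) → sum (λ i → x * f i + g i) ≡ x * sum f + sum g
  sum-*-+ x f g = trans (∑-distrib-+ (λ i → x * f i) g) (cong (_+ sum g) (sym (*-distribˡ-sum x f)))

  -- Polynomials as coefficient vectors, their roots, and divided differences.

  eval : ∀ {n} → Vector F n → F → F
  eval {zero}  v x = 0#
  eval {suc n} v x = v zero + x * eval (tail v) x

  -- The coefficients of the combination stay explicit, because one of them is inspected in
  -- `H₁-nonvanishing`.
  eval-linear : ∀ {N} n (c : Vector F N) (V : Fin N → Vector F n) x →
                sum (λ i → c i * eval (V i) x) ≡ eval (λ j → sum (λ i → c i * V i j)) x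
  eval-linear zero c V x = sum-zero (λ i → zeroʳ (c i))
  eval-linear (suc n) c V x = begin
    sum (λ i → c i * (V i zero + x * E i))
      ≡⟨ sum-cong-≗ (λ i → solve 4 (λ c v x e → c :* (v :+ x :* e) := x :* (c :* e) :+ c :* v)
                             refl (c i) (V i zero) x (E i)) ⟩
    sum (λ i → x * (c i * E i) + c i * V i zero)
      ≡⟨ sum-*-+ x (λ i → c i * E i) (λ i → c i * V i zero) ⟩
    x * sum (λ i → c i * E i) + sum (λ i → c i * V i zero)
      ≡⟨ cong (λ e → x * e + sum (λ i → c i * V i zero)) (eval-linear n c (tail ∘ V) x) ⟩
    x * eval (λ j → sum (λ i → c i * V i (suc j))) x + sum (λ i → c i * V i zero)
      ≡⟨ +-comm _ _ ⟩
    eval (λ j → sum (λ i → c i * V i j)) x ∎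
    where
    E : Vector F _
    E i = eval (tail (V i)) x

  eval-zero : ∀ {n} (v : Vector F n) → (∀ j → v j ≡ 0#) → ∀ x → eval v x ≡ 0#
  eval-zero {zero}  v v≡0 x = refl
  eval-zero {suc n} v v≡0 x = begin
    v zero + x * eval (tail v) x  ≡⟨ cong₂ (λ a b → a + x * b) (v≡0 zero) (eval-zero (tail v) (v≡0 ∘ suc) x) ⟩
    0# + x * 0#                   ≡⟨ solve 1 (λ x → con 0 :+ x :* con 0 := con 0) refl x ⟩
    0#                            ∎

  -- Synthetic division by X - r: each coefficient is the value at r of a tail of `v`.
  quot : ∀ {n} → F → Vector F (suc n) → Vector F n
  quot r v zero    = eval (tail v) r
  quot r v (suc j) = quot r (tail v) j

  -- The solver handles semirings only, so a difference enters it as an opaque d with x = r + d.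
  x≡r+[x-r] : ∀ x r → x ≡ r + (x - r)
  x≡r+[x-r] x r = begin
    x              ≡⟨ +-identityʳ x ⟨
    x + 0#         ≡⟨ cong (x +_) (-‿inverseˡ r) ⟨
    x + (- r + r)  ≡⟨ solve 3 (λ x n r → x :+ (n :+ r) := r :+ (x :+ n)) refl x (- r) r ⟩
    r + (x - r)    ∎

  eval-quot : ∀ {n} r (v : Vector F (suc n)) x → eval v x ≡ eval v r + (x - r) * eval (quot r v) x
  eval-quot {zero} r v x =
    solve 4 (λ a x r d → a :+ x :* con 0 := (a :+ r :* con 0) :+ d :* con 0) refl (v zero) x r (x - r)
  eval-quot {suc n} r v x = begin
    a + x * eval (tail v) x              ≡⟨ cong (λ e → a + x * e) (eval-quot r (tail v) x) ⟩
    a + x * (e + d * q)                  ≡⟨ cong (λ z → a + z * (e + d * q)) x≡r+d ⟩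
    a + (r + d) * (e + d * q)            ≡⟨ solve 5 (λ a r d e q →
          a :+ (r :+ d) :* (e :+ d :* q) := a :+ r :* e :+ d :* (e :+ (r :+ d) :* q))
                                                  refl a r d e q ⟩
    a + r * e + d * (e + (r + d) * q)    ≡⟨ cong (λ z → a + r * e + d * (e + z * q)) x≡r+d ⟨
    a + r * e + d * (e + x * q)          ∎
    where
    a = v zero
    d = x - r
    e = eval (tail v) r
    q = eval (quot r (tail v)) x
    x≡r+d = x≡r+[x-r] x r

  -- The first coefficient of the quotient is the value of the tail at r. Its vanishing reduces
  -- `vr≡0` to the constant coefficient and is also the hypothesis of the recursion on the tail.
  quot≡0⇒≡0 : ∀ {n} r (v : Vector F (suc n)) → eval v r ≡ 0# → (∀ j → quot r v j ≡ 0#) → ∀ j → v j ≡ 0#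
  quot≡0⇒≡0 {zero} r v vr≡0 q≡0 zero = begin
    v zero           ≡⟨ solve 2 (λ a r → a := a :+ r :* con 0) refl (v zero) r ⟩
    v zero + r * 0#  ≡⟨ vr≡0 ⟩
    0#               ∎
  quot≡0⇒≡0 {suc n} r v vr≡0 q≡0 zero = begin
    v zero                        ≡⟨ solve 2 (λ a r → a := a :+ r :* con 0) refl (v zero) r ⟩
    v zero + r * 0#               ≡⟨ cong (λ e → v zero + r * e) (q≡0 zero) ⟨
    v zero + r * eval (tail v) r  ≡⟨ vr≡0 ⟩
    0#                            ∎
  quot≡0⇒≡0 {suc n} r v vr≡0 q≡0 (suc j) = quot≡0⇒≡0 r (tail v) (q≡0 zero) (q≡0 ∘ suc) j

  -- Divide by X minus the first root; the other roots survive in the quotient since their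
  -- differences from the first are nonzero.
  roots⇒zero : ∀ {n} (v : Vector F n) (r : Vector F n) → Injective _≡_ _≡_ r →
               (∀ i → eval v (r i) ≡ 0#) → ∀ j → v j ≡ 0#
  roots⇒zero {suc n} v r r-inj vr≡0 = quot≡0⇒≡0 (r zero) v (vr≡0 zero)
    (roots⇒zero (quot (r zero) v) (r ∘ suc) (Fin.suc-injective ∘ r-inj) λ i →
      xy≡0⇒y≡0 (λ eq → Fin.0≢1+n (sym (r-inj (x-y≡0⇒x≡y _ _ eq)))) (begin
        (r (suc i) - r zero) * eval (quot (r zero) v) (r (suc i))
          ≡⟨ +-identityˡ _ ⟨
        0# + (r (suc i) - r zero) * eval (quot (r zero) v) (r (suc i))
          ≡⟨ cong (_+ (r (suc i) - r zero) * eval (quot (r zero) v) (r (suc i))) (vr≡0 zero) ⟨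
        eval v (r zero) + (r (suc i) - r zero) * eval (quot (r zero) v) (r (suc i))
          ≡⟨ eval-quot (r zero) v (r (suc i)) ⟨
        eval v (r (suc i))
          ≡⟨ vr≡0 (suc i) ⟩
        0# ∎))

  -- The coefficients of k + (aX + b)v(X); in the recursion `k` carries the contribution of `a` to
  -- the next coefficient.
  linearTimes : ∀ {n} → F → F → F → Vector F n → Vector F (suc n)
  linearTimes {zero}  k a b v zero    = k
  linearTimes {suc n} k a b v zero    = k + b * v zero
  linearTimes {suc n} k a b v (suc j) = linearTimes (a * v zero) a b (tail v) j

  eval-linearTimes : ∀ {n} k a b (v : Vector F n) x →
                     eval (linearTimes k a b v) x ≡ k + (a * x + b) * eval v x
  eval-linearTimes {zero} k a b v x =
    solve 4 (λ k a b x → k :+ x :* con 0 := k :+ (a :* x :+ b) :* con 0) refl k a b x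
  eval-linearTimes {suc n} k a b v x = begin
    (k + b * v zero) + x * eval (linearTimes (a * v zero) a b (tail v)) x
      ≡⟨ cong (λ e → (k + b * v zero) + x * e) (eval-linearTimes (a * v zero) a b (tail v) x) ⟩
    (k + b * v zero) + x * (a * v zero + (a * x + b) * eval (tail v) x)
      ≡⟨ solve 6 (λ k a b x v e → (k :+ b :* v) :+ x :* (a :* v :+ (a :* x :+ b) :* e) := k :+ (a :* x :+ b) :* (v :+ x :* e))
               refl k a b x (v zero) (eval (tail v) x) ⟩
    k + (a * x + b) * (v zero + x * eval (tail v) x) ∎

  -- Polynomial functions of degree less than n.
  IsPoly : ℕ → (F → F) → Set
  IsPoly n f = Σ (Vector F n) λ v → ∀ x → f x ≡ eval v x

  one-isPoly : IsPoly 1 λ _ → 1#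
  one-isPoly = (λ _ → 1#) , λ x → solve 1 (λ x → con 1 := con 1 :+ x :* con 0) refl x

  linear-isPoly : ∀ {n f} a b → IsPoly n f → IsPoly (suc n) λ x → (a * x + b) * f x
  linear-isPoly {f = f} a b (v , f≡v) = linearTimes 0# a b v , λ x → begin
    (a * x + b) * f x              ≡⟨ cong ((a * x + b) *_) (f≡v x) ⟩
    (a * x + b) * eval v x         ≡⟨ +-identityˡ _ ⟨
    0# + (a * x + b) * eval v x    ≡⟨ eval-linearTimes 0# a b v x ⟨
    eval (linearTimes 0# a b v) x  ∎

  linear^-isPoly : ∀ {n f} a b → IsPoly n f → ∀ m → IsPoly (m ℕ.+ n) λ x → (a * x + b) ^ m * f x
  linear^-isPoly {n} {f} a b (v , f≡v) zero = v , λ x → trans (*-identityˡ (f x)) (f≡v x)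
  linear^-isPoly {n} {f} a b p (suc m) with v , eq ← linear-isPoly a b (linear^-isPoly a b p m) =
    v , λ x → trans (*-assoc _ _ _) (eq x)

  sum-isPoly : ∀ {N n} (c : Vector F N) {f : Fin N → F → F} → (∀ i → IsPoly n (f i)) →
               IsPoly n λ x → sum λ i → c i * f i x
  sum-isPoly {n = n} c p = _ , λ x →
    trans (sum-cong-≗ λ i → cong (c i *_) (proj₂ (p i) x)) (eval-linear n c (proj₁ ∘ p) x)

  isPoly-zero : ∀ {n f} → IsPoly n f → (r : Vector F n) → Injective _≡_ _≡_ r →
                (∀ i → f (r i) ≡ 0#) → ∀ x → f x ≡ 0#
  isPoly-zero (v , f≡v) r r-inj fr≡0 x = trans (f≡v x)
    (eval-zero v (roots⇒zero v r r-inj λ i → trans (sym (f≡v (r i))) (fr≡0 i)) x)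

  -- The functional f ↦ Σ c i * f (e i) is the divided difference at the points e.
  weights : ∀ n (e : Vector F (suc n)) → Injective _≡_ _≡_ e → Σ (Vector F (suc n)) λ c →
            (∀ j → j < n → sum (λ i → c i * e i ^ j) ≡ 0#) × sum (λ i → c i * e i ^ n) ≡ 1#
  weights zero e e-inj = (λ _ → 1#) , (λ _ ()) , solve 0 (con 1 :* con 1 :+ con 0 := con 1) refl
  weights (suc n) e e-inj with c , low , top ← weights n (e ∘ suc) (Fin.suc-injective ∘ e-inj) =
    c′ , low′ , trans (shift n (ℕ.n<1+n n)) top
    where
    d≢0 : ∀ i → e (suc i) - e zero ≢ 0#
    d≢0 i eq = Fin.0≢1+n (sym (e-inj (x-y≡0⇒x≡y _ _ eq)))

    -- Dividing by the distance to `e zero` extends the weights from the other points; the weight at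
    -- `e zero` is then forced by the vanishing of moment 0.
    c″ : Vector F (suc n)
    c″ i = c i * proj₁ (inverse _ (d≢0 i))

    c″d≡c : ∀ i → c″ i * (e (suc i) - e zero) ≡ c i
    c″d≡c i = begin
      c i * w * d    ≡⟨ solve 3 (λ c w d → c :* w :* d := c :* (d :* w)) refl (c i) w d ⟩
      c i * (d * w)  ≡⟨ cong (c i *_) (proj₂ (inverse d (d≢0 i))) ⟩
      c i * 1#       ≡⟨ *-identityʳ (c i) ⟩
      c i            ∎
      where
      d = e (suc i) - e zero
      w = proj₁ (inverse d (d≢0 i))

    c′ : Vector F (suc (suc n))
    c′ zero    = - sum c″
    c′ (suc i) = c″ i

    T : ℕ → F
    T j = sum λ i → c′ i * e i ^ j

    T0≡0 : T 0 ≡ 0#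
    T0≡0 = begin
      - sum c″ * 1# + sum (λ i → c″ i * 1#)  ≡⟨ cong₂ _+_ (*-identityʳ _) (sum-cong-≗ λ i → *-identityʳ (c″ i)) ⟩
      - sum c″ + sum c″                      ≡⟨ -‿inverseˡ _ ⟩
      0#                                     ∎

    -- Split e (suc i) as e zero plus a difference: the first part gives the previous moment, and
    -- the second cancels the denominator in `c″`.
    rec : ∀ j → T (suc j) ≡ e zero * T j + sum (λ i → c i * e (suc i) ^ j)
    rec j = begin
      c₀ * (e₀ * e₀ ^ j) + sum (λ i → c″ i * (e (suc i) * e (suc i) ^ j))
        ≡⟨ cong (c₀ * (e₀ * e₀ ^ j) +_) (sum-cong-≗ λ i → begin
          c″ i * (e (suc i) * e (suc i) ^ j)
            ≡⟨ cong (λ z → c″ i * (z * e (suc i) ^ j)) (x≡r+[x-r] (e (suc i)) e₀) ⟩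
          c″ i * ((e₀ + (e (suc i) - e₀)) * e (suc i) ^ j)
            ≡⟨ solve 4 (λ c z d p → c :* ((z :+ d) :* p) := z :* (c :* p) :+ c :* d :* p)
                     refl (c″ i) e₀ (e (suc i) - e₀) (e (suc i) ^ j) ⟩
          e₀ * (c″ i * e (suc i) ^ j) + c″ i * (e (suc i) - e₀) * e (suc i) ^ j
            ≡⟨ cong (λ z → e₀ * (c″ i * e (suc i) ^ j) + z * e (suc i) ^ j) (c″d≡c i) ⟩
          e₀ * (c″ i * e (suc i) ^ j) + c i * e (suc i) ^ j ∎) ⟩
      c₀ * (e₀ * e₀ ^ j) + sum (λ i → e₀ * (c″ i * e (suc i) ^ j) + c i * e (suc i) ^ j)
        ≡⟨ cong (c₀ * (e₀ * e₀ ^ j) +_) (sum-*-+ e₀ (λ i → c″ i * e (suc i) ^ j) (λ i → c i * e (suc i) ^ j)) ⟩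
      c₀ * (e₀ * e₀ ^ j) + (e₀ * sum (λ i → c″ i * e (suc i) ^ j) + s)
        ≡⟨ solve 5 (λ c z p u s → c :* (z :* p) :+ (z :* u :+ s) := z :* (c :* p :+ u) :+ s)
                 refl c₀ e₀ (e₀ ^ j) _ s ⟩
      e₀ * T j + s ∎
      where
      c₀ = c′ zero
      e₀ = e zero
      s  = sum (λ i → c i * e (suc i) ^ j)

    -- These two are mutually recursive: once T j is 0, `rec` turns the next moment into moment j of
    -- the smaller point set.
    low′ : ∀ j → j < suc n → T j ≡ 0#
    shift : ∀ j → j < suc n → T (suc j) ≡ sum (λ i → c i * e (suc i) ^ j)

    low′ zero    _         = T0≡0
    low′ (suc j) (s≤s j<n) = trans (shift j (ℕ.m<n⇒m<1+n j<n)) (low j j<n)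

    shift j j<1+n = begin
      T (suc j)       ≡⟨ rec j ⟩
      e zero * T j + s  ≡⟨ cong (λ z → e zero * z + s) (low′ j j<1+n) ⟩
      e zero * 0# + s   ≡⟨ solve 2 (λ z s → z :* con 0 :+ s := s) refl (e zero) s ⟩
      s ∎
      where s = sum (λ i → c i * e (suc i) ^ j)

  -- Characteristic p and the Frobenius map.

  multiple·≡0 : ∀ {p n} x → p · 1# ≡ 0# → p ∣ n → n · x ≡ 0#
  multiple·≡0 {p} x p≡0 (divides q refl) = begin
    (q ℕ.* p) · x                ≡⟨ cong ((q ℕ.* p) ·_) (*-identityˡ x) ⟨
    (q ℕ.* p) · (1# * x)         ≡⟨ ×-assoc-* (q ℕ.* p) 1# x ⟨
    (q ℕ.* p) · 1# * x           ≡⟨ cong (_* x) (×1-homo-* q p) ⟩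
    q · 1# * p · 1# * x          ≡⟨ cong (λ z → q · 1# * z * x) p≡0 ⟩
    q · 1# * 0# * x              ≡⟨ solve 2 (λ q x → q :* con 0 :* x := con 0) refl (q · 1#) x ⟩
    0#                           ∎

  frobenius : ∀ {p} → Prime p → p · 1# ≡ 0# → ∀ x y → (x + y) ^ p ≡ x ^ p + y ^ p
  frobenius {zero} pp p≡0 x y = contradiction refl (ℕ.≢-nonZero⁻¹ 0 {{prime⇒nonZero pp}})
  frobenius {p@(suc p-1)} pp p≡0 x y = begin
    (x + y) ^ p                                      ≡⟨ theorem p x y ⟩
    T zero + sum (T ∘ suc)                           ≡⟨ cong (T zero +_) (sum-init-last (T ∘ suc)) ⟩
    T zero + (sum (init (T ∘ suc)) + last (T ∘ suc)) ≡⟨ cong₂ (λ a b → a + (b + last (T ∘ suc))) T0 (sum-zero mid) ⟩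
    y ^ p + (0# + last (T ∘ suc))                    ≡⟨ cong (λ z → y ^ p + (0# + z)) Tp ⟩
    y ^ p + (0# + x ^ p)                             ≡⟨ solve 2 (λ x y → y :+ (con 0 :+ x) := x :+ y)
                                                              refl (x ^ p) (y ^ p) ⟩
    x ^ p + y ^ p                                    ∎
    where
    T : Fin (suc p) → F
    T = binomialTerm x y p

    T0 : T zero ≡ y ^ p
    T0 = solve 1 (λ y → con 1 :* y :+ con 0 := y) refl (y ^ p)

    mid : ∀ i → init (T ∘ suc) i ≡ 0#
    -- After dropping both ends, entry `i` is binomial term number i + 1, strictly between 0 and
    -- `p`.
    mid i = multiple·≡0 _ p≡0 (prime∣C pp (s≤s z≤n)
      (s≤s (subst (_< p-1) (sym (Fin.toℕ-inject₁ i)) (Fin.toℕ<n i))))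

    Tp : last (T ∘ suc) ≡ x ^ p
    Tp rewrite Fin.toℕ-fromℕ p-1 | nCn≡1 p | ℕ.n∸n≡0 p-1 =
      solve 1 (λ x → x :* con 1 :+ con 0 := x) refl (x ^ p)

  frobenius-^ : ∀ {p} → Prime p → p · 1# ≡ 0# → ∀ e x y →
                (x + y) ^ (p ℕ.^ e) ≡ x ^ (p ℕ.^ e) + y ^ (p ℕ.^ e)
  frobenius-^ pp p≡0 zero x y = solve 2 (λ x y → (x :+ y) :* con 1 := x :* con 1 :+ y :* con 1) refl x y
  frobenius-^ {p} pp p≡0 (suc e) x y = begin
    (x + y) ^ (p ℕ.* p ℕ.^ e)                      ≡⟨ ^-assocʳ (x + y) p (p ℕ.^ e) ⟨
    ((x + y) ^ p) ^ (p ℕ.^ e)                      ≡⟨ cong (_^ (p ℕ.^ e)) (frobenius pp p≡0 x y) ⟩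
    (x ^ p + y ^ p) ^ (p ℕ.^ e)                    ≡⟨ frobenius-^ pp p≡0 e (x ^ p) (y ^ p) ⟩
    (x ^ p) ^ (p ℕ.^ e) + (y ^ p) ^ (p ℕ.^ e)      ≡⟨ cong₂ _+_ (^-assocʳ x p (p ℕ.^ e)) (^-assocʳ y p (p ℕ.^ e)) ⟩
    x ^ (p ℕ.* p ℕ.^ e) + y ^ (p ℕ.* p ℕ.^ e)      ∎

  -- The nonzero elements and Fermat's little theorem.

  module Units {n} (enum′ : F ↔ Fin (suc n)) where
    open Inverse enum′ using (to; from; strictlyInverseˡ; strictlyInverseʳ)

    elem : Fin (suc n) → F
    elem = from

    elem-injective : Injective _≡_ _≡_ elem
    elem-injective {i} {j} eq = trans (sym (strictlyInverseˡ i)) (trans (cong to eq) (strictlyInverseˡ j))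

    unit : Fin n → F
    unit = removeAt elem (to 0#)

    unit≢0 : ∀ j → unit j ≢ 0#
    unit≢0 j eq = Fin.punchInᵢ≢i (to 0#) j
      (elem-injective (trans eq (sym (strictlyInverseʳ 0#))))

    unit-injective : Injective _≡_ _≡_ unit
    unit-injective = Fin.punchIn-injective (to 0#) _ _ ∘ elem-injective

    multiplication : ∀ x → x ≢ 0# → F ↔ F
    multiplication x x≢0 with w , xw≡1 ← inverse x x≢0 = mk↔ₛ′ (x *_) (w *_)
      (λ y → trans (sym (*-assoc x w y)) (trans (cong (_* y) xw≡1) (*-identityˡ y)))
      (λ y → trans (sym (*-assoc w x y)) (trans (cong (_* y) (trans (*-comm w x) xw≡1)) (*-identityˡ y)))

    -- Multiplication by x permutes F; g is the identity off 0, so comparing the products of g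
    -- over F before and after the permutation leaves a factor x for each nonzero element.
    x^n≡1 : ∀ x → x ≢ 0# → x ^ n ≡ 1#
    x^n≡1 x x≢0 = *-cancelˡ (product (g ∘ elem)) g≢0 (begin
      product (g ∘ elem) * x ^ n                      ≡⟨ *-comm _ _ ⟩
      x ^ n * product (g ∘ elem)                      ≡⟨ cong (_* product (g ∘ elem)) ∏h≡xⁿ ⟨
      product (h ∘ elem) * product (g ∘ elem)         ≡⟨ ∏-distrib-* (h ∘ elem) (g ∘ elem) ⟨
      product (λ i → h (elem i) * g (elem i))         ≡⟨ product-cong (λ i →
                                                           trans (g-mult (elem i)) (cong g (sym (strictlyInverseʳ _)))) ⟩
      product (λ i → g (elem (to (x * elem i))))      ≡⟨ product-permute (g ∘ elem)
                                                           (enum′ ↔-∘ (multiplication x x≢0 ↔-∘ ↔-sym enum′)) ⟨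
      product (g ∘ elem)                              ≡⟨ *-identityʳ _ ⟨
      product (g ∘ elem) * 1#                         ∎)
      where
      -- `h` is the factor by which `g` changes under multiplication by `x`; its value 1 at 0 makes
      -- the exponent n rather than n + 1.
      g h : F → F
      g y with y ≟ 0#
      ... | yes _ = 1#
      ... | no _  = y
      h y with y ≟ 0#
      ... | yes _ = 1#
      ... | no _  = x

      g≢0′ : ∀ y → g y ≢ 0#
      g≢0′ y with y ≟ 0#
      ... | yes _  = 0≢1 ∘ sym
      ... | no y≢0 = y≢0

      product≢0 : ∀ {k} (f : Vector F k) → (∀ i → f i ≢ 0#) → product f ≢ 0#
      product≢0 {zero}  f f≢0 = 0≢1 ∘ sym
      product≢0 {suc k} f f≢0 = *-nonzero (f≢0 zero) (product≢0 (tail f) (f≢0 ∘ suc))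

      g≢0 = product≢0 (g ∘ elem) (g≢0′ ∘ elem)

      g-mult : ∀ y → h y * g y ≡ g (x * y)
      g-mult y with y ≟ 0# | x * y ≟ 0#
      ... | yes _    | yes _    = *-identityˡ 1#
      ... | yes refl | no xy≢0  = contradiction (zeroʳ x) xy≢0
      ... | no y≢0   | yes xy≡0 = contradiction xy≡0 (*-nonzero x≢0 y≢0)
      ... | no _     | no _     = refl

      h0 : h 0# ≡ 1#
      h0 with 0# ≟ 0#
      ... | yes _  = refl
      ... | no 0≢0 = contradiction refl 0≢0

      h≢0 : ∀ y → y ≢ 0# → h y ≡ x
      h≢0 y y≢0 with y ≟ 0#
      ... | yes y≡0 = contradiction y≡0 y≢0
      ... | no _    = refl

      ∏h≡xⁿ : product (h ∘ elem) ≡ x ^ n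
      ∏h≡xⁿ = begin
        product (h ∘ elem)                                ≡⟨ product-remove {i = to 0#} (h ∘ elem) ⟩
        h (elem (to 0#)) * product (h ∘ unit)             ≡⟨ cong₂ _*_ (trans (cong h (strictlyInverseʳ 0#)) h0)
                                                               (product-cong (λ j → h≢0 (unit j) (unit≢0 j))) ⟩
        1# * product (replicate n x)                      ≡⟨ *-identityˡ _ ⟩
        product (replicate n x)                           ≡⟨ product-replicate n ⟩
        x ^ n                                             ∎

  -- Tools for interpolation: moments, powers of linear forms, prescribed roots.

  sum-*-poly≡0 : ∀ {N n} (c e : Vector F N) → (∀ j → j < n → sum (λ i → c i * e i ^ j) ≡ 0#) →
                 ∀ {f} → IsPoly n f → sum (λ i → c i * f (e i)) ≡ 0#
  sum-*-poly≡0 c e moments {f} (v , f≡v) =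
    trans (sum-cong-≗ λ i → cong (c i *_) (f≡v (e i))) (go c moments v)
    where
    -- Horner's rule moves a factor `e i` into the weights, which shifts the moments by one; hence
    -- the generalisation over `c`.
    go : ∀ {n} (c : Vector F _) → (∀ j → j < n → sum (λ i → c i * e i ^ j) ≡ 0#) →
         (v : Vector F n) → sum (λ i → c i * eval v (e i)) ≡ 0#
    go {zero} c moments v = sum-zero λ i → zeroʳ (c i)
    go {suc n} c moments v = begin
      sum (λ i → c i * (v zero + e i * eval (tail v) (e i)))
        ≡⟨ sum-cong-≗ (λ i → solve 4 (λ c a e q → c :* (a :+ e :* q) := a :* (c :* con 1) :+ c :* e :* q)
                               refl (c i) (v zero) (e i) (eval (tail v) (e i))) ⟩
      sum (λ i → v zero * (c i * 1#) + c i * e i * eval (tail v) (e i))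
        ≡⟨ sum-*-+ (v zero) (λ i → c i * 1#) (λ i → c i * e i * eval (tail v) (e i)) ⟩
      v zero * sum (λ i → c i * 1#) + sum (λ i → c i * e i * eval (tail v) (e i))
        ≡⟨ cong₂ (λ a b → v zero * a + b) (moments 0 (s≤s z≤n))
             (go (λ i → c i * e i)
               (λ j j<n → trans (sum-cong-≗ λ i → *-assoc (c i) (e i) (e i ^ j)) (moments (suc j) (s≤s j<n)))
               (tail v)) ⟩
      v zero * 0# + 0#
        ≡⟨ solve 1 (λ a → a :* con 0 :+ con 0 := con 0) refl (v zero) ⟩
      0# ∎

  -- A concrete vector rather than an `IsPoly` witness, since its coefficient at index 1 is computed
  -- below.
  linearPower : F → F → ∀ m → Vector F (suc m)
  linearPower a b zero    = λ _ → 1#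
  linearPower a b (suc m) = linearTimes 0# a b (linearPower a b m)

  eval-linearPower : ∀ a b m x → (a * x + b) ^ m ≡ eval (linearPower a b m) x
  eval-linearPower a b zero x = proj₂ one-isPoly x
  eval-linearPower a b (suc m) x = proj₂ (linear-isPoly a b (linearPower a b m , eval-linearPower a b m)) x

  linearPower-0 : ∀ a b m → linearPower a b m zero ≡ b ^ m
  linearPower-0 a b zero = refl
  linearPower-0 a b (suc m) = trans (+-identityˡ _) (cong (b *_) (linearPower-0 a b m))

  linearPower-1 : ∀ a b m → linearPower a b (suc m) (suc zero) ≡ suc m · (a * b ^ m)
  linearPower-1 a b zero = sym (+-identityʳ (a * 1#))
  linearPower-1 a b (suc m) = cong₂ _+_ (cong (a *_) (linearPower-0 a b (suc m))) (begin
    b * linearPower a b (suc m) (suc zero)  ≡⟨ cong (b *_) (linearPower-1 a b m) ⟩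
    b * (suc m · (a * b ^ m))               ≡⟨ ×-comm-* (suc m) b (a * b ^ m) ⟩
    suc m · (b * (a * b ^ m))               ≡⟨ cong (suc m ·_) (solve 3 (λ a b p → b :* (a :* p) := a :* (b :* p))
                                                                      refl a b (b ^ m)) ⟩
    suc m · (a * (b * b ^ m))               ∎)

  -- The product of the X - r l, with `1# * x` in each factor to match `linear-isPoly`.
  vanishingAt : ∀ {m} (r : Vector F m) → ∃ λ P → IsPoly (suc m) P ×
                (∀ l → P (r l) ≡ 0#) × (∀ x → (∀ l → x ≢ r l) → P x ≢ 0#)
  vanishingAt {zero} r = (λ _ → 1#) , one-isPoly , (λ ()) , λ _ _ → 0≢1 ∘ sym
  vanishingAt {suc m} r with P , poly , P≡0 , P≢0 ← vanishingAt (r ∘ suc) =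
    (λ x → (1# * x + - r zero) * P x) , linear-isPoly 1# (- r zero) poly , Q≡0 , Q≢0
    where
    Q≡0 : ∀ l → (1# * r l + - r zero) * P (r l) ≡ 0#
    Q≡0 zero = begin
      (1# * r zero + - r zero) * P (r zero)  ≡⟨ cong (λ z → (z + - r zero) * P (r zero)) (*-identityˡ (r zero)) ⟩
      (r zero + - r zero) * P (r zero)       ≡⟨ cong (_* P (r zero)) (-‿inverseʳ (r zero)) ⟩
      0# * P (r zero)                        ≡⟨ zeroˡ _ ⟩
      0#                                     ∎
    Q≡0 (suc l) = trans (cong ((1# * r (suc l) + - r zero) *_) (P≡0 l)) (zeroʳ _)

    Q≢0 : ∀ x → (∀ l → x ≢ r l) → (1# * x + - r zero) * P x ≢ 0#
    Q≢0 x x≢r = *-nonzero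
      (λ eq → x≢r zero (x-y≡0⇒x≡y _ _ (trans (cong (_+ - r zero) (sym (*-identityˡ x))) eq)))
      (P≢0 x (x≢r ∘ suc))

  -- On these points X^n would agree with the constant c, but the divided difference is 1 on the
  -- former and 0 on the latter.
  roots-of-xⁿ≡c : ∀ {n} c → 0 < n → (r : Vector F (suc n)) → Injective _≡_ _≡_ r → ¬ (∀ i → r i ^ n ≡ c)
  roots-of-xⁿ≡c {n} c 0<n r r-inj rⁿ≡c with w , low , top ← weights n r r-inj = 0≢1 (begin
    0#                          ≡⟨ zeroʳ c ⟨
    c * 0#                      ≡⟨ cong (c *_) (low 0 0<n) ⟨
    c * sum (λ i → w i * 1#)    ≡⟨ *-distribˡ-sum c (λ i → w i * 1#) ⟩
    sum (λ i → c * (w i * 1#))  ≡⟨ sum-cong-≗ (λ i → solve 2 (λ c w → c :* (w :* con 1) := w :* c)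
                                                           refl c (w i)) ⟩
    sum (λ i → w i * c)         ≡⟨ sum-cong-≗ (λ i → cong (w i *_) (rⁿ≡c i)) ⟨
    sum (λ i → w i * r i ^ n)   ≡⟨ top ⟩
    1#                          ∎)

  length-roots-of-xⁿ≡c : ∀ {n} → 0 < n → ∀ c xs → Unique xs → All (λ x → x ^ n ≡ c) xs → length xs ≤ n
  length-roots-of-xⁿ≡c {n} 0<n c xs xs! xsⁿ≡c with length xs ℕ.≤? n
  ... | yes ≤n = ≤n
  ... | no ≰n = contradiction (λ i → All.lookup xsⁿ≡c (∈-lookup (inject≤ i (ℕ.≰⇒> ≰n))))
    (roots-of-xⁿ≡c c 0<n (λ i → List.lookup xs (inject≤ i (ℕ.≰⇒> ≰n)))
      (Fin.inject≤-injective _ _ _ _ ∘ lookup-injective xs!))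

  -- The interpolation argument: H, its values and the defects.

  module Interpolation
    {t m} (frob : ∀ x y → (x + y) ^ t ≡ x ^ t + y ^ t)
    (m·1≢0 : m · 1# ≢ 0#) (m<t : m < t) {λ′} (λ′≢0 : λ′ ≢ 0#)
    (e : Vector F (suc t)) (e-inj : Injective _≡_ _≡_ e)
    (pair-^ : ∀ i j → i ≢ j → (e i * e j + λ′) ^ (t ℕ.* m) ≡ (e i * e j + λ′) ^ m)
    where

    pair : Fin (suc t) → Fin (suc t) → F
    pair i j = e i * e j + λ′

    -- Additivity gives x^t - y^t = (x - y)^t, which is nonzero when x ≠ y.
    ^t-injective : Injective _≡_ _≡_ (_^ t)
    ^t-injective {x} {y} xᵗ≡yᵗ with x ≟ y
    ... | yes x≡y = x≡y
    ... | no x≢y = contradiction (begin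
      (x - y) ^ t                    ≡⟨ +-identityʳ _ ⟨
      (x - y) ^ t + 0#               ≡⟨ cong ((x - y) ^ t +_) (-‿inverseʳ (y ^ t)) ⟨
      (x - y) ^ t + (y ^ t - y ^ t)  ≡⟨ solve 3 (λ d a b → d :+ (a :+ b) := (a :+ d) :+ b)
                                              refl ((x - y) ^ t) (y ^ t) (- y ^ t) ⟩
      y ^ t + (x - y) ^ t - y ^ t    ≡⟨ cong (_- y ^ t) (frob y (x - y)) ⟨
      (y + (x - y)) ^ t - y ^ t      ≡⟨ cong (λ z → z ^ t - y ^ t) (x≡r+[x-r] x y) ⟨
      x ^ t - y ^ t                  ≡⟨ x≡y⇒x-y≡0 xᵗ≡yᵗ ⟩
      0#                             ∎)
      (^-nonzero t (λ eq → x≢y (x-y≡0⇒x≡y x y eq)))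

    c : Vector F (suc t)
    c = proj₁ (weights t e e-inj)

    moments : ∀ j → j < t → sum (λ i → c i * e i ^ j) ≡ 0#
    moments = proj₁ (proj₂ (weights t e e-inj))

    H : (F → F) → F → F
    H P y = sum λ i → c i * P (e i) * (e i ^ t * y + λ′ ^ t) ^ m

    H-isPoly : ∀ P → IsPoly (suc m) (H P)
    H-isPoly P = sum-isPoly (λ i → c i * P (e i)) λ i →
      linearPower (e i ^ t) (λ′ ^ t) m , eval-linearPower (e i ^ t) (λ′ ^ t) m

    -- Too many roots would make every coefficient zero, but the coefficient of y is a unit: the sum
    -- of the c i * e i ^ t is 1, leaving a multiple of 1 and a power of `λ′`.
    H₁-nonvanishing : ¬ (∀ j → H (λ _ → 1#) (e j ^ t) ≡ 0#)
    H₁-nonvanishing = nonvanishing m m·1≢0 m<t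
      where
      nonvanishing : ∀ m → m · 1# ≢ 0# → m < t →
        ¬ (∀ j → sum (λ i → c i * 1# * (e i ^ t * e j ^ t + λ′ ^ t) ^ m) ≡ 0#)
      nonvanishing zero    m·1≢0 m<t H≡0 = m·1≢0 refl
      nonvanishing (suc m) m·1≢0 m<t H≡0 =
        *-nonzero m·1≢0 (^-nonzero m (^-nonzero t λ′≢0)) (begin
          M * B                                          ≡⟨ *-identityʳ _ ⟨
          M * B * 1#                                     ≡⟨ cong (M * B *_) (proj₂ (proj₂ (weights t e e-inj))) ⟨
          M * B * sum (λ i → c i * e i ^ t)              ≡⟨ *-distribˡ-sum (M * B) (λ i → c i * e i ^ t) ⟩
          sum (λ i → M * B * (c i * e i ^ t))            ≡⟨ sum-cong-≗ (λ i → begin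
            M * B * (c i * e i ^ t)                        ≡⟨ solve 4 (λ M B c a →
                                                               M :* B :* (c :* a) := c :* con 1 :* (M :* (a :* B)))
                                                                    refl M B (c i) (e i ^ t) ⟩
            c i * 1# * (M * (e i ^ t * B))                 ≡⟨ cong (c i * 1# *_) (×-assoc-* (suc m) 1# (e i ^ t * B)) ⟩
            c i * 1# * (suc m · (1# * (e i ^ t * B)))      ≡⟨ cong (λ z → c i * 1# * (suc m · z)) (*-identityˡ _) ⟩
            c i * 1# * (suc m · (e i ^ t * B))             ≡⟨ cong (c i * 1# *_) (linearPower-1 (e i ^ t) (λ′ ^ t) m) ⟨
            c i * 1# * V i (suc zero)                      ∎) ⟩
          W (suc zero)                                   ≡⟨ W≡0 (suc zero) ⟩
          0#                                             ∎)
        where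
        M B : F
        M = suc m · 1#
        B = (λ′ ^ t) ^ m
        V : Fin (suc t) → Vector F (suc (suc m))
        V i = linearPower (e i ^ t) (λ′ ^ t) (suc m)
        W : Vector F (suc (suc m))
        W j = sum λ i → c i * 1# * V i j
        ι : Fin (suc (suc m)) → Fin (suc t)
        -- With exponent `suc m` there are m + 2 coefficients, so m + 2 of the t + 1 points serve as
        -- roots.
        ι i = inject≤ i (ℕ.m≤n⇒m≤1+n m<t)
        W≡0 : ∀ j → W j ≡ 0#
        W≡0 = roots⇒zero W (λ i → e (ι i) ^ t)
          (Fin.inject≤-injective _ _ _ _ ∘ e-inj ∘ ^t-injective) λ i → begin
            eval W (e (ι i) ^ t)
              ≡⟨ eval-linear (suc (suc m)) (λ i → c i * 1#) V (e (ι i) ^ t) ⟨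
            sum (λ l → c l * 1# * eval (V l) (e (ι i) ^ t))
              ≡⟨ sum-cong-≗ (λ l → cong (c l * 1# *_) (eval-linearPower (e l ^ t) (λ′ ^ t) (suc m) (e (ι i) ^ t))) ⟨
            sum (λ l → c l * 1# * (e l ^ t * e (ι i) ^ t + λ′ ^ t) ^ suc m)
              ≡⟨ H≡0 (ι i) ⟩
            0# ∎

    -- The D_j of the overview: the error of replacing the exponent tm by m in the diagonal term.
    defect : Fin (suc t) → F
    defect j = c j * (pair j j ^ (t ℕ.* m) - pair j j ^ m)

    -- Frobenius turns each summand into a power tm of a pair. Off the diagonal `pair-^` lowers it
    -- to m, after which the functional sees a polynomial of degree below t and gives 0; only the
    -- diagonal error survives.
    H-at-point : ∀ {n P} → IsPoly n P → m ℕ.+ n ≤ t → ∀ j → H P (e j ^ t) ≡ P (e j) * defect j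
    H-at-point {n} {P} poly m+n≤t j = begin
      H P (e j ^ t)
        ≡⟨ sum-cong-≗ (λ i → cong (c i * P (e i) *_) (pair-frob i)) ⟩
      sum U
        ≡⟨ sum-remove {i = j} U ⟩
      c j * P (e j) * pair j j ^ (t ℕ.* m) + sum (removeAt U j)
        ≡⟨ cong₂ (λ a b → c j * P (e j) * a + b) (x≡r+[x-r] _ (pair j j ^ m)) (sum-cong-≗ λ l →
             cong (c (punchIn j l) * P (e (punchIn j l)) *_) (pair-^ _ _ (Fin.punchInᵢ≢i j l))) ⟩
      c j * P (e j) * (pair j j ^ m + δ) + sum (removeAt V j)
        ≡⟨ solve 5 (λ c P v δ s → c :* P :* (v :+ δ) :+ s := (c :* P :* v :+ s) :+ P :* (c :* δ))
                 refl (c j) (P (e j)) (pair j j ^ m) δ (sum (removeAt V j)) ⟩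
      c j * P (e j) * pair j j ^ m + sum (removeAt V j) + P (e j) * defect j
        ≡⟨ cong (_+ P (e j) * defect j) (sum-remove {i = j} V) ⟨
      sum V + P (e j) * defect j
        ≡⟨ cong (_+ P (e j) * defect j) ∑V≡0 ⟩
      0# + P (e j) * defect j
        ≡⟨ +-identityˡ _ ⟩
      P (e j) * defect j ∎
      where
      δ : F
      δ = pair j j ^ (t ℕ.* m) - pair j j ^ m
      U V : Vector F (suc t)
      U i = c i * P (e i) * pair i j ^ (t ℕ.* m)
      V i = c i * P (e i) * pair i j ^ m

      pair-frob : ∀ i → (e i ^ t * e j ^ t + λ′ ^ t) ^ m ≡ pair i j ^ (t ℕ.* m)
      pair-frob i = begin
        (e i ^ t * e j ^ t + λ′ ^ t) ^ m    ≡⟨ cong (λ z → (z + λ′ ^ t) ^ m) (^-distrib-* (e i) (e j) t) ⟨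
        ((e i * e j) ^ t + λ′ ^ t) ^ m      ≡⟨ cong (_^ m) (frob (e i * e j) λ′) ⟨
        (pair i j ^ t) ^ m                  ≡⟨ ^-assocʳ (pair i j) t m ⟩
        pair i j ^ (t ℕ.* m)                ∎

      ∑V≡0 : sum V ≡ 0#
      -- The functional is applied here to P(X)(e_j X + `λ′`)^m, which has at most m + n
      -- coefficients.
      ∑V≡0 = trans
        (sum-cong-≗ λ i → trans
          (solve 3 (λ c p v → c :* p :* v := c :* (v :* p)) refl (c i) (P (e i)) (pair i j ^ m))
          (cong (λ z → c i * ((z + λ′) ^ m * P (e i))) (*-comm (e i) (e j))))
        (sum-*-poly≡0 c e (λ l l<m+n → moments l (ℕ.<-≤-trans l<m+n m+n≤t)) (linear^-isPoly (e j) λ′ poly m))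

    defect-nonvanishing : ¬ (∀ j → defect j ≡ 0#)
    defect-nonvanishing defect≡0 = H₁-nonvanishing λ j → begin
      H (λ _ → 1#) (e j ^ t)  ≡⟨ H-at-point one-isPoly (subst (_≤ t) (ℕ.+-comm 1 m) m<t) j ⟩
      1# * defect j           ≡⟨ *-identityˡ _ ⟩
      defect j                ≡⟨ defect≡0 j ⟩
      0#                      ∎

    square-^⇒defect≡0 : ∀ j → pair j j ^ (t ℕ.* m) ≡ pair j j ^ m → defect j ≡ 0#
    square-^⇒defect≡0 j eq = trans (cong (c j *_) (x≡y⇒x-y≡0 eq)) (zeroʳ (c j))

    -- H P has m + 1 roots when P vanishes at the points ι: their t-th powers and that of e z.
    defect≡0 : m ℕ.+ suc m ≤ t → ∀ {z} → defect z ≡ 0# →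
               ∀ j → (ι : Fin m → Fin (suc t)) → Injective _≡_ _≡_ ι →
               (∀ l → ι l ≢ z) → (∀ l → ι l ≢ j) → defect j ≡ 0#
    defect≡0 2m<t {z} z≡0 j ι ι-inj ι≢z ι≢j
      with P , poly , P≡0 , P≢0 ← vanishingAt (e ∘ ι) =
      xy≡0⇒y≡0 (P≢0 (e j) λ l eq → ι≢j l (sym (e-inj eq))) (begin
        P (e j) * defect j  ≡⟨ H-at-point poly 2m<t j ⟨
        H P (e j ^ t)       ≡⟨ isPoly-zero (H-isPoly P) (λ i → e (κ i) ^ t) (κ-inj ∘ e-inj ∘ ^t-injective) root (e j ^ t) ⟩
        0#                  ∎)
      where
      κ : Fin (suc m) → Fin (suc t)
      κ zero    = z
      κ (suc l) = ι l
      κ-inj : Injective _≡_ _≡_ κ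
      κ-inj {zero}  {zero}  eq = refl
      κ-inj {zero}  {suc l} eq = contradiction (sym eq) (ι≢z l)
      κ-inj {suc l} {zero}  eq = contradiction eq (ι≢z l)
      κ-inj {suc k} {suc l} eq = cong suc (ι-inj eq)
      -- At `z` the defect vanishes; at the points of `ι` the factor P does.
      root : ∀ i → H P (e (κ i) ^ t) ≡ 0#
      root zero    = trans (H-at-point poly 2m<t z) (trans (cong (P (e z) *_) z≡0) (zeroʳ _))
      root (suc l) = trans (H-at-point poly 2m<t (ι l)) (trans (cong (_* defect (ι l)) (P≡0 l)) (zeroˡ _))

  -- Closure properties of the d-th powers.

  x^n≡x*x^[n∸1] : ∀ {n} x → 0 < n → x ^ n ≡ x * x ^ (n ∸ 1)
  x^n≡x*x^[n∸1] {suc n} x _ = refl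

  InS⇒≢0 : ∀ d {y} → InS d y → y ≢ 0#
  InS⇒≢0 d (x , x≢0 , xᵈ≡y) y≡0 =
    ^-nonzero d x≢0 (trans (sym (^ᴷ≡^ x d)) (trans xᵈ≡y y≡0))

  InS-* : ∀ d {y z} → InS d y → InS d z → InS d (y * z)
  InS-* d {y} {z} (u , u≢0 , uᵈ≡y) (v , v≢0 , vᵈ≡z) = u * v , *-nonzero u≢0 v≢0 , (begin
    (u * v) ^ᴷ d     ≡⟨ ^ᴷ≡^ (u * v) d ⟩
    (u * v) ^ d      ≡⟨ ^-distrib-* u v d ⟩
    u ^ d * v ^ d    ≡⟨ cong₂ _*_ (trans (sym (^ᴷ≡^ u d)) uᵈ≡y) (trans (sym (^ᴷ≡^ v d)) vᵈ≡z) ⟩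
    y * z            ∎)

  -- Fields of order t²: the norm and the subfield of order t.

  module SquareOrder
    {t m d} (2≤t : 2 ≤ t) (1+t≡md : suc t ≡ m ℕ.* d) (2≤d : 2 ≤ d)
    (enum′ : F ↔ Fin (suc ((t ∸ 1) ℕ.* suc t)))
    (frob : ∀ x y → (x + y) ^ t ≡ x ^ t + y ^ t) (t·1≡0 : t · 1# ≡ 0#)
    where

    0<m : 0 < m
    0<m = ℕ.n≢0⇒n>0 λ { refl → ℕ.1+n≢0 1+t≡md }

    0<t : 0 < t
    0<t = ℕ.<⇒≤ 2≤t

    -- In the field md = t + 1 becomes 1, so m is invertible there.
    m·1≢0 : m · 1# ≢ 0#
    m·1≢0 m≡0 = 0≢1 (begin
      0#                   ≡⟨ zeroˡ (d · 1#) ⟨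
      0# * d · 1#          ≡⟨ cong (_* d · 1#) m≡0 ⟨
      m · 1# * d · 1#      ≡⟨ ×1-homo-* m d ⟨
      (m ℕ.* d) · 1#       ≡⟨ cong (_· 1#) 1+t≡md ⟨
      1# + t · 1#          ≡⟨ cong (1# +_) t·1≡0 ⟩
      1# + 0#              ≡⟨ +-identityʳ 1# ⟩
      1#                   ∎)

    open Units enum′

    xᵗᵗ≡x : ∀ x → x ≢ 0# → x ^ (t ℕ.* t) ≡ x
    xᵗᵗ≡x x x≢0 = begin
      x ^ (t ℕ.* t)                    ≡⟨ cong (x ^_) (n*n≡1+[n∸1]*[1+n] 0<t) ⟩
      x * x ^ ((t ∸ 1) ℕ.* suc t)      ≡⟨ cong (x *_) (x^n≡1 x x≢0) ⟩
      x * 1#                           ≡⟨ *-identityʳ x ⟩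
      x                                ∎

    -- For y = x^d the power y^m is the norm x^(t+1), which the t-th power fixes because x^(t²) = x.
    -- At y = 0 both exponents are positive.
    InS₀⇒^ : ∀ {y} → InS₀ d y → y ^ (t ℕ.* m) ≡ y ^ m
    InS₀⇒^ (inj₂ refl) = trans (0^n (ℕ.*-mono-< 0<t 0<m)) (sym (0^n 0<m))
    InS₀⇒^ (inj₁ (x , x≢0 , refl)) = subst (λ y → y ^ (t ℕ.* m) ≡ y ^ m) (sym (^ᴷ≡^ x d)) (begin
      (x ^ d) ^ (t ℕ.* m)      ≡⟨ ^-assocʳ x d (t ℕ.* m) ⟩
      x ^ (d ℕ.* (t ℕ.* m))    ≡⟨ cong (x ^_) (trans (ℕ.*-comm d (t ℕ.* m)) (ℕ.*-assoc t m d)) ⟩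
      x ^ (t ℕ.* (m ℕ.* d))    ≡⟨ cong (λ n → x ^ (t ℕ.* n)) 1+t≡md ⟨
      x ^ (t ℕ.* suc t)        ≡⟨ cong (x ^_) (ℕ.*-suc t t) ⟩
      x ^ (t ℕ.+ t ℕ.* t)      ≡⟨ ^-homo-* x t (t ℕ.* t) ⟩
      x ^ t * x ^ (t ℕ.* t)    ≡⟨ cong (x ^ t *_) (xᵗᵗ≡x x x≢0) ⟩
      x ^ t * x                ≡⟨ *-comm _ x ⟩
      x ^ suc t                ≡⟨ cong (x ^_) (trans 1+t≡md (ℕ.*-comm m d)) ⟩
      x ^ (d ℕ.* m)            ≡⟨ ^-assocʳ x d m ⟨
      (x ^ d) ^ m              ∎)

    units : List F
    units = List.tabulate unit

    -- Duplicate-free, so that it can enumerate the nonzero elements of the subfield of order t.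
    norms : List F
    norms = deduplicate _≟_ (map (_^ suc t) units)

    norms! : Unique norms
    norms! = DecUnique.deduplicate-! _≟_ (map (_^ suc t) units)

    ∈norms⇒norm : ∀ {z} → z ∈ norms → ∃ λ x → x ≢ 0# × z ≡ x ^ suc t
    ∈norms⇒norm z∈norms
      with x , x∈units , z≡ ← ∈-map⁻ (_^ suc t) (∈-deduplicate⁻ _≟_ _ z∈norms)
      with j , refl ← ∈-tabulate⁻ {f = unit} x∈units = unit j , unit≢0 j , z≡

    norm^≡1 : ∀ {z} → (∃ λ x → x ≢ 0# × z ≡ x ^ suc t) → z ^ (t ∸ 1) ≡ 1#
    norm^≡1 (x , x≢0 , refl) = begin
      (x ^ suc t) ^ (t ∸ 1)      ≡⟨ ^-assocʳ x (suc t) (t ∸ 1) ⟩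
      x ^ (suc t ℕ.* (t ∸ 1))    ≡⟨ cong (x ^_) (ℕ.*-comm (suc t) (t ∸ 1)) ⟩
      x ^ ((t ∸ 1) ℕ.* suc t)    ≡⟨ x^n≡1 x x≢0 ⟩
      1#                         ∎

    ∈norms⇒^≡1 : ∀ {z} → z ∈ norms → z ^ (t ∸ 1) ≡ 1#
    ∈norms⇒^≡1 z∈norms = norm^≡1 (∈norms⇒norm z∈norms)

    -- The (t - 1)(t + 1) units lie in norm fibres of at most t + 1 elements each.
    t∸1≤length-norms : t ∸ 1 ≤ length norms
    t∸1≤length-norms = ℕ.*-cancelʳ-≤ (t ∸ 1) (length norms) (suc t)
      (subst (_≤ length norms ℕ.* suc t) (length-tabulate unit)
        (length≤fibre*image _≟_ (_^ suc t) (suc t) (length-roots-of-xⁿ≡c (s≤s z≤n)) norms units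
          (Unique.tabulate⁺ unit-injective)
          (All.tabulate λ x∈units → ∈-deduplicate⁺ _≟_ (∈-map⁺ (_^ suc t) x∈units))))

    -- A solution outside `norms` would be one more than the t - 1 solutions that the equation can
    -- have.
    ^≡1⇒∈norms : ∀ {z} → z ^ (t ∸ 1) ≡ 1# → z ∈ norms
    ^≡1⇒∈norms {z} z^≡1 with Any.any? (z ≟_) norms
    ... | yes z∈norms = z∈norms
    ... | no z∉norms = contradiction
      (length-roots-of-xⁿ≡c (ℕ.∸-monoˡ-≤ 1 2≤t) 1# (z ∷ norms)
        (All.¬Any⇒All¬ norms z∉norms ∷ norms!) (z^≡1 ∷ All.tabulate ∈norms⇒^≡1))
      (ℕ.<⇒≱ (s≤s t∸1≤length-norms))

    norm⇒subfield : ∀ {z} → z ∈ norms → z ^ t ≡ z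
    norm⇒subfield {z} z∈norms =
      trans (x^n≡x*x^[n∸1] z 0<t) (trans (cong (z *_) (∈norms⇒^≡1 z∈norms)) (*-identityʳ z))

    norm⇒InS : ∀ {z} → (∃ λ x → x ≢ 0# × z ≡ x ^ suc t) → InS d z
    norm⇒InS (x , x≢0 , refl) = x ^ m , ^-nonzero m x≢0 , (begin
      (x ^ m) ^ᴷ d       ≡⟨ ^ᴷ≡^ (x ^ m) d ⟩
      (x ^ m) ^ d        ≡⟨ ^-assocʳ x m d ⟩
      x ^ (m ℕ.* d)      ≡⟨ cong (x ^_) 1+t≡md ⟨
      x ^ suc t          ∎)

    -- The subfield is encoded as the fixed points of the t-th power. Cancelling z gives z^(t-1) =
    -- 1, so z is a norm, and norms are d-th powers as t + 1 = md.
    subfield⇒InS : ∀ {z} → z ≢ 0# → z ^ t ≡ z → InS d z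
    subfield⇒InS {z} z≢0 zᵗ≡z = norm⇒InS (∈norms⇒norm (^≡1⇒∈norms
      (*-cancelˡ z z≢0 (trans (sym (x^n≡x*x^[n∸1] z 0<t)) (trans zᵗ≡z (sym (*-identityʳ z)))))))

    -- The lower bound, from a multiple of the subfield.

    module _ {α β} (α²∈S : InS d (α ^ 2)) (β≢0 : β ≢ 0#) (βᵗ≡β : β ^ t ≡ β) where

      λ′ : F
      λ′ = α ^ 2 * β

      λ′∈S : InS d λ′
      λ′∈S = InS-* d α²∈S (subfield⇒InS β≢0 βᵗ≡β)

      -- The elements are α times the norms. A factor α² comes out of each αu · αv + α²β, and the
      -- cofactor uv + β stays in the subfield.
      construction : Σ (Vector F (t ∸ 1)) (HasSD d λ′ (t ∸ 1))
      construction = (λ i → α * u i) , (inj , nonzero) , pairs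
        where
        α≢0 : α ≢ 0#
        α≢0 refl = InS⇒≢0 d α²∈S (zeroˡ _)

        ι : Fin (t ∸ 1) → Fin (length norms)
        ι i = inject≤ i t∸1≤length-norms

        u : Vector F (t ∸ 1)
        u = List.lookup norms ∘ ι

        u-subfield : ∀ i → u i ^ t ≡ u i
        u-subfield i = norm⇒subfield (∈-lookup (ι i))

        nonzero : ∀ i → α * u i ≢ 0#
        nonzero i = let x , x≢0 , u≡x^[1+t] = ∈norms⇒norm (∈-lookup (ι i)) in
          *-nonzero α≢0 (λ u≡0 → ^-nonzero (suc t) x≢0 (trans (sym u≡x^[1+t]) u≡0))

        inj : Injective _≡_ _≡_ λ i → α * u i
        inj = Fin.inject≤-injective _ _ _ _ ∘ lookup-injective norms! ∘ *-cancelˡ α α≢0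

        pair≡ : ∀ i j → (α * u i) * (α * u j) + λ′ ≡ α ^ 2 * (u i * u j + β)
        pair≡ i j = solve 4 (λ a u v b →
          (a :* u) :* (a :* v) :+ (a :* (a :* con 1)) :* b := (a :* (a :* con 1)) :* (u :* v :+ b))
          refl α (u i) (u j) β

        pairs : ∀ i j → InS₀ d ((α * u i) * (α * u j) + λ′)
        pairs i j = subst (InS₀ d) (sym (pair≡ i j)) (α²z∈S (u i * u j + β) (begin
          (u i * u j + β) ^ t          ≡⟨ frob (u i * u j) β ⟩
          (u i * u j) ^ t + β ^ t      ≡⟨ cong (_+ β ^ t) (^-distrib-* (u i) (u j) t) ⟩
          u i ^ t * u j ^ t + β ^ t    ≡⟨ cong₂ _+_ (cong₂ _*_ (u-subfield i) (u-subfield j)) βᵗ≡β ⟩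
          u i * u j + β                ∎))
          where
          α²z∈S : ∀ z → z ^ t ≡ z → InS₀ d (α ^ 2 * z)
          α²z∈S z zᵗ≡z with z ≟ 0#
          ... | yes z≡0 = inj₂ (trans (cong (α ^ 2 *_) z≡0) (zeroʳ _))
          ... | no z≢0  = inj₁ (InS-* d α²∈S (subfield⇒InS z≢0 zᵗ≡z))

      -- The upper bound, from t elements together with 0.

      module UpperBound {n} (a : Vector F n) (hasD : HasD d λ′ n a) (t≤n : t ≤ n) where

        e : Vector F (suc t)
        e zero    = 0#
        e (suc i) = a (inject≤ i t≤n)

        a≢0 = proj₂ (proj₁ hasD)

        e-inj : Injective _≡_ _≡_ e
        e-inj {zero}  {zero}  eq = refl
        e-inj {zero}  {suc j} eq = contradiction (sym eq) (a≢0 _)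
        e-inj {suc i} {zero}  eq = contradiction eq (a≢0 _)
        e-inj {suc i} {suc j} eq =
          cong suc (Fin.inject≤-injective _ _ _ _ (proj₁ (proj₁ hasD) eq))

        λ′+0∈S : ∀ {x} → x ≡ 0# → InS₀ d (x + λ′)
        λ′+0∈S refl = inj₁ (subst (InS d) (sym (+-identityˡ λ′)) λ′∈S)

        pair∈S : ∀ i j → i ≢ j → InS₀ d (e i * e j + λ′)
        pair∈S zero    j       i≢j = λ′+0∈S (zeroˡ (e j))
        pair∈S (suc i) zero    i≢j = λ′+0∈S (zeroʳ (e (suc i)))
        pair∈S (suc i) (suc j) i≢j =
          proj₂ hasD _ _ (i≢j ∘ cong suc ∘ Fin.inject≤-injective _ _ _ _)

        pair-^ : ∀ i j → i ≢ j → (e i * e j + λ′) ^ (t ℕ.* m) ≡ (e i * e j + λ′) ^ m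
        pair-^ i j i≢j = InS₀⇒^ (pair∈S i j i≢j)

        open Interpolation frob m·1≢0 (m<t 1+t≡md 2≤d 2≤t) (InS⇒≢0 d λ′∈S) e e-inj
          pair-^

        -- The diagonal condition at the added point 0 only says that `λ′` is in S_d, so it holds
        -- under `HasD` too and provides the extra root for H.
        defect-zero≡0 : defect zero ≡ 0#
        defect-zero≡0 = square-^⇒defect≡0 zero (InS₀⇒^ (λ′+0∈S (zeroˡ 0#)))

        ¬HasSD : ¬ HasSD d λ′ n a
        ¬HasSD hasSD = defect-nonvanishing λ where
          zero    → defect-zero≡0
          (suc j) → square-^⇒defect≡0 (suc j) (InS₀⇒^ (proj₂ hasSD _ _))

        d≥3-impossible : ¬ (m ℕ.+ suc m ≤ t)
        d≥3-impossible 2m<t = defect-nonvanishing all≡0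
          where
          m≤t∸1 : m ≤ t ∸ 1
          m≤t∸1 = ℕ.≤-trans (ℕ.m≤m+n m m) (ℕ.pred-mono-≤ (subst (_≤ t) (ℕ.+-suc m m) 2m<t))
          all≡0 : ∀ j → defect j ≡ 0#
          all≡0 zero    = defect-zero≡0
          -- The roots of P are chosen among the nonzero points other than `j`; hence the shift of
          -- `ι` by `suc`.
          all≡0 (suc j) = let ι , ι-inj , ι≢j = avoiding m≤t∸1 j in
            defect≡0 2m<t defect-zero≡0 (suc j) (suc ∘ ι) (ι-inj ∘ Fin.suc-injective)
              (λ _ ()) (λ l → ι≢j l ∘ Fin.suc-injective)

      ≤t∸1 : ∀ {n} → ¬ (t ≤ n) → n ≤ t ∸ 1
      ≤t∸1 t≰n = ℕ.pred-mono-≤ (ℕ.≰⇒> t≰n)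

      HasSD⇒HasD : ∀ n a → HasSD d λ′ n a → HasD d λ′ n a
      HasSD⇒HasD n a (distinct , pairs) = distinct , λ i j _ → pairs i j

      msd : MSD≡ d λ′ (t ∸ 1)
      msd = construction , λ n a hasSD → ≤t∸1 λ t≤n →
        UpperBound.¬HasSD a (HasSD⇒HasD n a hasSD) t≤n hasSD

      md : 5 ≤ t → 3 ≤ d → MD≡ d λ′ (t ∸ 1)
      md 5≤t 3≤d = (proj₁ construction , HasSD⇒HasD _ _ (proj₂ construction)) , λ n a hasD → ≤t∸1 λ t≤n →
        UpperBound.d≥3-impossible a hasD t≤n (2m<t 1+t≡md 3≤d 5≤t)

theorem1p5 : (K : FiniteField) → let open FiniteField K in
    (p s t d : ℕ) → Prime p → fromℕ p ≡ 0# →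
    order ≡ p Data.Nat.^ s → order ≡ t Data.Nat.* t →
    2 ≤ d → d ∣ suc t →
    {{_ : NonZero d}} → {{_ : NonZero (p Data.Nat.* t)}} →
    (λ' : F) → λ' ≢ 0# →
    (∃ λ α → InS d (α ^ 2) × ∃ λ β → β ≢ 0# × β ^ t ≡ β × λ' ≡ (α ^ 2) * β) →
    ((order ∸ 1) / d) % (p Data.Nat.* t) ≤ (p ∸ 1) Data.Nat.* t →
    MSD≡ d λ' (t ∸ 1) × (25 ≤ order → 3 ≤ d → MD≡ d λ' (t ∸ 1))
theorem1p5 K p s t d pp p≡0 q≡pˢ q≡tt 2≤d (divides m 1+t≡md) λ' _ (α , α²∈S , β , β≢0 , βᵗ≡β , refl) _ =
  msd α²∈S β≢0 βᵗ≡β′ , λ 25≤q → md α²∈S β≢0 βᵗ≡β′ (5≤t 25≤q)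
  where
  open Field K

  p·1≡0 : p · 1# ≡ 0#
  p·1≡0 = trans (sym (fromℕ≡·1 p)) p≡0

  -- Otherwise the field has at most one element and 0 = 1.
  2≤t : 2 ≤ t
  2≤t = ℕ.≮⇒≥ λ t<2 → 0≢1 (trivial (ℕ.*-mono-≤ (ℕ.≤-pred t<2) (ℕ.≤-pred t<2)))
    where
    open Inverse enum using (to; from; strictlyInverseʳ)
    trivial : t ℕ.* t ≤ 1 → 0# ≡ 1#
    trivial tt≤1 = trans (sym (strictlyInverseʳ 0#)) (trans
      (cong from (unique (subst (_≤ 1) (sym q≡tt) tt≤1) (to 0#) (to 1#))) (strictlyInverseʳ 1#))
      where
      unique : ∀ {n} → n ≤ 1 → (i j : Fin n) → i ≡ j
      unique (s≤s z≤n) zero zero = refl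

  enum′ : F ↔ Fin (suc ((t ∸ 1) ℕ.* suc t))
  enum′ = subst (λ n → F ↔ Fin n) (trans q≡tt (n*n≡1+[n∸1]*[1+n] (ℕ.<⇒≤ 2≤t))) enum

  5≤t : 25 ≤ order → 5 ≤ t
  -- If t ≤ 4 then t² ≤ 16, contradicting 17 ≤ 25 ≤ t².
  5≤t 25≤q = ℕ.≮⇒≥ λ { (s≤s t≤4) → ℕ.<⇒≱ (s≤s (ℕ.*-mono-≤ t≤4 t≤4))
    (ℕ.≤-trans (ℕ.m≤n+m 17 8) (subst (25 ≤_) q≡tt 25≤q)) }

  βᵗ≡β′ : β ^ t ≡ β
  βᵗ≡β′ = trans (sym (^ᴷ≡^ β t)) βᵗ≡β

  prime-power : ∃ λ e → t ≡ p ℕ.^ e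
  prime-power = sqrt-of-prime-power pp s (trans (sym q≡tt) q≡pˢ)

  frob : ∀ x y → (x + y) ^ t ≡ x ^ t + y ^ t
  frob with e , refl ← prime-power = frobenius-^ pp p·1≡0 e

  t·1≡0 : t · 1# ≡ 0#
  t·1≡0 with prime-power
  -- Exponent 0 would mean t = 1; any other exponent makes t a multiple of the characteristic.
  ... | zero  , refl = contradiction 2≤t λ { (s≤s ()) }
  ... | suc e , refl = multiple·≡0 {p} 1# p·1≡0 (m∣m*n (p ℕ.^ e))

  open SquareOrder {m = m} 2≤t 1+t≡md 2≤d enum′ frob t·1≡0
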